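{- Let $G=(V,A)$ be a connected digraph with $|A|=m$, and let $T=(V,\hat A)$ be an oriented spanning tree of $G$ with $\hat A\subset A$ and $|\hat A|=n\ge 1$. Let $\mathbf{M}\in\mathbb{R}^{n\times m}$ be the network matrix associated with $G$ and $T$. Then $\mathbf{M}$ is a positive spanning set for $\mathbb{R}^n$ if and only if $G$ is strongly edge-connected.
   Context: A digraph $G=(V,A)$ has a finite vertex set $V$ and a finite set $A$ of arcs (ordered pairs of vertices). It is connected if its underlying undirected graph is connected; it is strongly edge-connected (strongly connected) if for any $(u,v)\in V^2$ there is a directed path from $u$ to $v$. An oriented spanning tree of $G$ is a digraph $T=(V,\hat A)$ with $\hat A\subset A$ whose underlying undirected graph is a tree. Network matrix: write $A=\{(u_j,v_j)\}_{j=1}^m$ and $\hat A=\{(\hat u_i,\hat v_i)\}_{i=1}^n$ (arbitrary fixed orderings). The network matrix of $G$ and $T$ is $\mathbf{M}\in\mathbb{R}^{n\times m}$ where $\mathbf{M}_{i,j}=0$ if the unique (undirected) path from $u_j$ to $v_j$ in $T$ does not pass through $(\hat u_i,\hat v_i)$, $\mathbf{M}_{i,j}=1$ if this path traverses $(\hat u_i,\hat v_i)$ in the forward direction, and $\mathbf{M}_{i,j}=-1$ if it traverses it in the backward direction. Positive spanning set: for $\mathbf{D}\in\mathbb{R}^{n\times m}$, $\mathrm{pspan}(\mathbf{D})=\{\mathbf{D}\mathbf{x} : \mathbf{x}\in\mathbb{R}^m,\ \mathbf{x}\ge \mathbf{0}\}$; $\mathbf{D}$ is a positive spanning set (PSS)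 of a linear subspace $\mathbb{L}\subset\mathbb{R}^n$ if $\mathrm{pspan}(\mathbf{D})=\mathbb{L}$. -}

module Defs where

open import Data.Empty using (⊥)
open import Data.Fin using (Fin; _≟_)
open import Data.List using (List; []; _∷_)
open import Data.List.Relation.Unary.Unique.Propositional using (Unique)
open import Data.Maybe using (Maybe; just; nothing)
open import Data.Nat as ℕ using (ℕ)
import Data.Nat.Properties as ℕ
open import Data.Product using (∃; ∃₂; _×_; _,_; proj₁; proj₂)
open import Data.Rational as ℚ using (ℚ; 0ℚ; 1ℚ; ½; ∣_∣)
import Data.Rational.Properties as ℚ
open import Data.Rational.Solver using (module +-*-Solver)
open import Data.Unit using (tt)
open import Data.Vec.Functional using (Vector; foldr; map; zipWith; replicate)
open import Data.Vec.Functional.Relation.Binary.Pointwise using (Pointwise)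
open import Function.Definitions using (Injective)
open import Level using (0ℓ)
open import Relation.Binary using (Rel)
open import Relation.Binary.Construct.Closure.Equivalence using (EqClosure)
open import Relation.Binary.Construct.Closure.ReflexiveTransitive using (Star; ε; _◅_)
open import Relation.Binary.Construct.Closure.Symmetric using (SymClosure; fwd; bwd)
open import Relation.Binary.PropositionalEquality using (_≡_; refl; sym; trans; cong; cong₂)
open import Relation.Nullary using (¬_; yes; no)
open import Relation.Unary using (Pred; U; _≐_)

-- Real numbers by Cantor's construction: Cauchy sequences of rationals
-- identified up to `_≃_`.

IsCauchy : (ℕ → ℚ) → Set
IsCauchy s = ∀ δ → 0ℚ ℚ.< δ →
  ∃ λ N → ∀ k l → N ℕ.≤ k → N ℕ.≤ l → ∣ s k ℚ.- s l ∣ ℚ.< δ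

record ℝ : Set where
  constructor mkℝ
  field
    seq    : ℕ → ℚ
    cauchy : IsCauchy seq
open ℝ public

infix 4 _≃_ _≤_

_≃_ : Rel ℝ 0ℓ
x ≃ y = ∀ δ → 0ℚ ℚ.< δ → ∃ λ N → ∀ k → N ℕ.≤ k → ∣ seq x k ℚ.- seq y k ∣ ℚ.< δ

_≤_ : Rel ℝ 0ℓ
x ≤ y = ∀ δ → 0ℚ ℚ.< δ → ∃ λ N → ∀ k → N ℕ.≤ k → seq x k ℚ.< seq y k ℚ.+ δ

private
  open ℚ.≤-Reasoning
  open +-*-Solver

  ½δ>0 : ∀ δ → 0ℚ ℚ.< δ → 0ℚ ℚ.< ½ ℚ.* δ
  ½δ>0 δ δ>0 = ℚ.<-respˡ-≡ (ℚ.*-zeroʳ ½) (ℚ.*-monoʳ-<-pos ½ δ>0)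

  ½δ+½δ : ∀ δ → ½ ℚ.* δ ℚ.+ ½ ℚ.* δ ≡ δ
  ½δ+½δ δ = trans (sym (ℚ.*-distribʳ-+ δ ½ ½)) (ℚ.*-identityˡ δ)

  +-close : ∀ γ a b c d → ∣ a ℚ.- c ∣ ℚ.< γ → ∣ b ℚ.- d ∣ ℚ.< γ →
    ∣ (a ℚ.+ b) ℚ.- (c ℚ.+ d) ∣ ℚ.< γ ℚ.+ γ
  +-close γ a b c d ac bd = begin-strict
    ∣ (a ℚ.+ b) ℚ.- (c ℚ.+ d) ∣    ≡⟨ cong ∣_∣ (regroup a b c d) ⟩
    ∣ (a ℚ.- c) ℚ.+ (b ℚ.- d) ∣    ≤⟨ ℚ.∣p+q∣≤∣p∣+∣q∣ (a ℚ.- c) (b ℚ.- d) ⟩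
    ∣ a ℚ.- c ∣ ℚ.+ ∣ b ℚ.- d ∣    <⟨ ℚ.+-mono-< ac bd ⟩
    γ ℚ.+ γ                        ∎
    where
    regroup : ∀ a b c d → (a ℚ.+ b) ℚ.- (c ℚ.+ d) ≡ (a ℚ.- c) ℚ.+ (b ℚ.- d)
    regroup = solve 4 (λ a b c d → (a :+ b) :- (c :+ d) := (a :- c) :+ (b :- d)) refl

  *-small : ∀ {A γ} a b → 0ℚ ℚ.< A → ∣ a ∣ ℚ.≤ A → ∣ b ∣ ℚ.< γ →
    ∣ a ℚ.* b ∣ ℚ.< A ℚ.* γ
  *-small {A} {γ} a b A>0 a≤A b<γ = begin-strict
    ∣ a ℚ.* b ∣      ≡⟨ ℚ.∣p*q∣≡∣p∣*∣q∣ a b ⟩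
    ∣ a ∣ ℚ.* ∣ b ∣  ≤⟨ ℚ.*-monoʳ-≤-nonNeg ∣ b ∣ {{ℚ.∣-∣-nonNeg b}} a≤A ⟩
    A ℚ.* ∣ b ∣      <⟨ ℚ.*-monoʳ-<-pos A {{ℚ.positive A>0}} b<γ ⟩
    A ℚ.* γ          ∎

  *-close : ∀ {A B α β} a b c d → 0ℚ ℚ.< A → 0ℚ ℚ.< B → ∣ a ∣ ℚ.≤ A → ∣ d ∣ ℚ.≤ B →
    ∣ a ℚ.- c ∣ ℚ.< α → ∣ b ℚ.- d ∣ ℚ.< β →
    ∣ a ℚ.* b ℚ.- c ℚ.* d ∣ ℚ.< A ℚ.* β ℚ.+ B ℚ.* α
  *-close {A} {B} {α} {β} a b c d A>0 B>0 a≤A d≤B ac bd = begin-strict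
    ∣ a ℚ.* b ℚ.- c ℚ.* d ∣
      ≡⟨ cong ∣_∣ (regroup a b c d) ⟩
    ∣ a ℚ.* (b ℚ.- d) ℚ.+ d ℚ.* (a ℚ.- c) ∣
      ≤⟨ ℚ.∣p+q∣≤∣p∣+∣q∣ (a ℚ.* (b ℚ.- d)) (d ℚ.* (a ℚ.- c)) ⟩
    ∣ a ℚ.* (b ℚ.- d) ∣ ℚ.+ ∣ d ℚ.* (a ℚ.- c) ∣
      <⟨ ℚ.+-mono-< (*-small a (b ℚ.- d) A>0 a≤A bd) (*-small d (a ℚ.- c) B>0 d≤B ac) ⟩
    A ℚ.* β ℚ.+ B ℚ.* α ∎
    where
    regroup : ∀ a b c d →
      a ℚ.* b ℚ.- c ℚ.* d ≡ a ℚ.* (b ℚ.- d) ℚ.+ d ℚ.* (a ℚ.- c)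
    regroup = solve 4
      (λ a b c d → a :* b :- c :* d := a :* (b :- d) :+ d :* (a :- c)) refl

  ≤-near : ∀ {γ} a b → ∣ a ℚ.- b ∣ ℚ.< γ → ∣ a ∣ ℚ.≤ γ ℚ.+ ∣ b ∣
  ≤-near {γ} a b ab = begin
    ∣ a ∣                  ≡⟨ cong ∣_∣ (regroup a b) ⟩
    ∣ (a ℚ.- b) ℚ.+ b ∣    ≤⟨ ℚ.∣p+q∣≤∣p∣+∣q∣ (a ℚ.- b) b ⟩
    ∣ a ℚ.- b ∣ ℚ.+ ∣ b ∣  ≤⟨ ℚ.+-monoˡ-≤ ∣ b ∣ (ℚ.<⇒≤ ab) ⟩
    γ ℚ.+ ∣ b ∣            ∎
    where
    regroup : ∀ a b → a ≡ (a ℚ.- b) ℚ.+ b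
    regroup = solve 2 (λ a b → a := (a :- b) :+ b) refl

  shrink : ∀ B δ → 0ℚ ℚ.< B → 0ℚ ℚ.< δ → ∃ λ γ → 0ℚ ℚ.< γ × B ℚ.* γ ≡ δ
  shrink B δ B>0 δ>0 = γ , γ>0 , Bγ≡δ
    where
    instance
      B-pos : ℚ.Positive B
      B-pos = ℚ.positive B>0
      B-nonZero : ℚ.NonZero B
      B-nonZero = ℚ.pos⇒nonZero B
      1/B-pos : ℚ.Positive (ℚ.1/ B)
      1/B-pos = ℚ.1/pos⇒pos B
    γ : ℚ
    γ = ℚ.1/ B ℚ.* δ
    γ>0 : 0ℚ ℚ.< γ
    γ>0 = ℚ.<-respˡ-≡ (ℚ.*-zeroʳ (ℚ.1/ B)) (ℚ.*-monoʳ-<-pos (ℚ.1/ B) δ>0)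
    Bγ≡δ : B ℚ.* γ ≡ δ
    Bγ≡δ = trans (sym (ℚ.*-assoc B (ℚ.1/ B) δ))
             (trans (cong (ℚ._* δ) (ℚ.*-inverseʳ B)) (ℚ.*-identityˡ δ))

  eventually-bounded : ∀ {s} → IsCauchy s →
    ∃₂ λ N B → 0ℚ ℚ.< B × (∀ k → N ℕ.≤ k → ∣ s k ∣ ℚ.≤ B)
  eventually-bounded {s} cs =
    let N , h = cs 1ℚ (ℚ.positive⁻¹ 1ℚ) in
    N , 1ℚ ℚ.+ ∣ s N ∣
      , ℚ.+-mono-<-≤ (ℚ.positive⁻¹ 1ℚ) (ℚ.0≤∣p∣ (s N))
      , λ k k≥ → ≤-near (s k) (s N) (h k N k≥ ℕ.≤-refl)

  +-cauchy : ∀ s t → IsCauchy s → IsCauchy t → IsCauchy (λ k → s k ℚ.+ t k)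
  +-cauchy s t cs ct δ δ>0 =
    let M , hs = cs (½ ℚ.* δ) (½δ>0 δ δ>0)
        N , ht = ct (½ ℚ.* δ) (½δ>0 δ δ>0)
    in M ℕ.⊔ N , λ k l k≥ l≥ → ℚ.<-respʳ-≡ (½δ+½δ δ)
         (+-close (½ ℚ.* δ) (s k) (t k) (s l) (t l)
           (hs k l (ℕ.m⊔n≤o⇒m≤o M N k≥) (ℕ.m⊔n≤o⇒m≤o M N l≥))
           (ht k l (ℕ.m⊔n≤o⇒n≤o M N k≥) (ℕ.m⊔n≤o⇒n≤o M N l≥)))

  *-cauchy : ∀ s t → IsCauchy s → IsCauchy t → IsCauchy (λ k → s k ℚ.* t k)
  *-cauchy s t cs ct δ δ>0 =
    let P , A , A>0 , s≤A = eventually-bounded cs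
        Q , B , B>0 , t≤B = eventually-bounded ct
        α , α>0 , Bα = shrink B (½ ℚ.* δ) B>0 (½δ>0 δ δ>0)
        β , β>0 , Aβ = shrink A (½ ℚ.* δ) A>0 (½δ>0 δ δ>0)
        M , hs = cs α α>0
        N , ht = ct β β>0
    in (P ℕ.⊔ Q) ℕ.⊔ (M ℕ.⊔ N) , λ k l k≥ l≥ →
         let PQ≤k = ℕ.m⊔n≤o⇒m≤o (P ℕ.⊔ Q) (M ℕ.⊔ N) k≥
             PQ≤l = ℕ.m⊔n≤o⇒m≤o (P ℕ.⊔ Q) (M ℕ.⊔ N) l≥
             MN≤k = ℕ.m⊔n≤o⇒n≤o (P ℕ.⊔ Q) (M ℕ.⊔ N) k≥
             MN≤l = ℕ.m⊔n≤o⇒n≤o (P ℕ.⊔ Q) (M ℕ.⊔ N) l≥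
         in ℚ.<-respʳ-≡ (trans (cong₂ ℚ._+_ Aβ Bα) (½δ+½δ δ))
              (*-close (s k) (t k) (s l) (t l) A>0 B>0
                (s≤A k (ℕ.m⊔n≤o⇒m≤o P Q PQ≤k))
                (t≤B l (ℕ.m⊔n≤o⇒n≤o P Q PQ≤l))
                (hs k l (ℕ.m⊔n≤o⇒m≤o M N MN≤k) (ℕ.m⊔n≤o⇒m≤o M N MN≤l))
                (ht k l (ℕ.m⊔n≤o⇒n≤o M N MN≤k) (ℕ.m⊔n≤o⇒n≤o M N MN≤l)))

fromℚ : ℚ → ℝ
fromℚ q .seq _ = q
fromℚ q .cauchy δ δ>0 = 0 , λ _ _ _ _ →
  ℚ.<-respˡ-≡ (sym (cong ∣_∣ (ℚ.+-inverseʳ q))) δ>0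

0ℝ 1ℝ -1ℝ : ℝ
0ℝ  = fromℚ 0ℚ
1ℝ  = fromℚ 1ℚ
-1ℝ = fromℚ (ℚ.- 1ℚ)

infixl 6 _+_
infixl 7 _*_

_+_ _*_ : ℝ → ℝ → ℝ
(x + y) .seq k  = seq x k ℚ.+ seq y k
(x + y) .cauchy = +-cauchy (seq x) (seq y) (cauchy x) (cauchy y)
(x * y) .seq k  = seq x k ℚ.* seq y k
(x * y) .cauchy = *-cauchy (seq x) (seq y) (cauchy x) (cauchy y)

Matrix : ℕ → ℕ → Set
Matrix n m = Vector (Vector ℝ m) n

infixr 7 _*ᵥ_

_*ᵥ_ : ∀ {n m} → Matrix n m → Vector ℝ m → Vector ℝ n
(D *ᵥ x) i = foldr _+_ 0ℝ (zipWith _*_ (D i) x)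

record Subspace (n : ℕ) : Set₁ where
  field
    member   : Pred (Vector ℝ n) 0ℓ
    resp     : ∀ {v w} → Pointwise _≃_ v w → member v → member w
    0-closed : member (replicate n 0ℝ)
    +-closed : ∀ {v w} → member v → member w → member (zipWith _+_ v w)
    *-closed : ∀ c {v} → member v → member (map (c *_) v)

ℝ^ : ∀ n → Subspace n
ℝ^ n = record
  { member   = U
  ; resp     = λ _ _ → tt
  ; 0-closed = tt
  ; +-closed = λ _ _ → tt
  ; *-closed = λ _ _ → tt
  }

pspan : ∀ {n m} → Matrix n m → Pred (Vector ℝ n) 0ℓ
pspan {m = m} D w =
  ∃ λ (x : Vector ℝ m) → (∀ j → 0ℝ ≤ x j) × Pointwise _≃_ (D *ᵥ x) w

IsPositiveSpanningSet : ∀ {n m} → Matrix n m → Subspace n → Set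
IsPositiveSpanningSet D L = pspan D ≐ Subspace.member L

-- Vertex set `Fin p`; `arc` enumerates the arc set without repetition, so
-- |A| = m and the ordering of A is part of the data.  Loops and pairs of
-- opposite arcs are allowed.
record Digraph (p m : ℕ) : Set where
  field
    arc           : Fin m → Fin p × Fin p
    arc-injective : Injective _≡_ _≡_ arc
open Digraph public

Arc : ∀ {p m} → Digraph p m → Rel (Fin p) 0ℓ
Arc G u v = ∃ λ j → arc G j ≡ (u , v)

Walk : ∀ {p m} → Digraph p m → Rel (Fin p) 0ℓ
Walk G = EqClosure (Arc G)

DirectedWalk : ∀ {p m} → Digraph p m → Rel (Fin p) 0ℓ
DirectedWalk G = Star (Arc G)

vertices : ∀ {A : Set} {R : Rel A 0ℓ} {u v} → Star R u v → List A
vertices {u = u} ε       = u ∷ []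
vertices {u = u} (_ ◅ w) = u ∷ vertices w

Path : ∀ {p m} → Digraph p m → Rel (Fin p) 0ℓ
Path G u v = ∃ λ (w : Walk G u v) → Unique (vertices w)

DirectedPath : ∀ {p m} → Digraph p m → Rel (Fin p) 0ℓ
DirectedPath G u v = ∃ λ (w : DirectedWalk G u v) → Unique (vertices w)

Connected : ∀ {p m} → Digraph p m → Set
Connected G = ∀ u v → Path G u v

StronglyConnected : ∀ {p m} → Digraph p m → Set
StronglyConnected G = ∀ u v → DirectedPath G u v

stepArc : ∀ {p m} (G : Digraph p m) {u v} → SymClosure (Arc G) u v → Fin m
stepArc G (fwd (j , _)) = j
stepArc G (bwd (j , _)) = j

arcs : ∀ {p m} (G : Digraph p m) {u v} → Walk G u v → List (Fin m)
arcs G ε       = []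
arcs G (s ◅ w) = stepArc G s ∷ arcs G w

-- The underlying undirected graph has one edge per arc: a loop is a cycle of
-- length 1, and two opposite arcs form a cycle of length 2.  The start vertex
-- of a cycle is omitted from the list required to be repetition-free, since
-- it recurs at the end.
IsCycle : ∀ {p m} (G : Digraph p m) {u} → Walk G u u → Set
IsCycle G ε       = ⊥
IsCycle G (s ◅ w) = Unique (vertices w) × Unique (arcs G (s ◅ w))

Acyclic : ∀ {p m} → Digraph p m → Set
Acyclic G = ∀ {u} (w : Walk G u u) → ¬ IsCycle G w

IsTree : ∀ {p m} → Digraph p m → Set
IsTree T = Connected T × Acyclic T

record IsOrientedSpanningTree {p m n} (G : Digraph p m) (T : Digraph p n) : Set where
  field
    arcs⊆ : ∀ {u v} → Arc T u v → Arc G u v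
    tree  : IsTree T

data Direction : Set where
  forward backward : Direction

stepDirection : ∀ {p m} (G : Digraph p m) {u v} → SymClosure (Arc G) u v → Direction
stepDirection G (fwd _) = forward
stepDirection G (bwd _) = backward

-- The direction in which a walk (first) traverses arc i, if it does so at all;
-- a path traverses no arc twice.
traversal : ∀ {p m} (G : Digraph p m) {u v} → Fin m → Walk G u v → Maybe Direction
traversal G i ε = nothing
traversal G i (s ◅ w) with i ≟ stepArc G s
... | yes _ = just (stepDirection G s)
... | no  _ = traversal G i w

entry : Maybe Direction → ℝ
entry nothing         = 0ℝ
entry (just forward)  = 1ℝ
entry (just backward) = -1ℝ

-- Connectedness of T supplies the path from u_j to v_j; it is the only one
-- because T is acyclic.
networkMatrix : ∀ {p m n} (G : Digraph p m) (T : Digraph p n) →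
                IsOrientedSpanningTree G T → Matrix n m
networkMatrix G T T-span i j = entry (traversal T i (proj₁ path))
  where
  path : Path T (proj₁ (arc G j)) (proj₂ (arc G j))
  path = proj₁ (IsOrientedSpanningTree.tree T-span) _ _

{-# OPTIONS --safe #-}

-- The signed number of times a walk of T crosses an arc of T depends only on the endpoints
-- of the walk, since T is acyclic.  Hence the columns of M along a directed walk of G sum to
-- the signed incidence vector of any walk of T with the same endpoints.  If G is strongly
-- connected, directed walks along and against each arc of T put ±e_i in the cone.
-- Conversely, if v is not reachable from u, let S be the set of vertices reachable from u and
-- y the gradient of its indicator along the arcs of T.  Then y·M is the gradient along the
-- arcs of G, which is nonnegative as no arc leaves S, while y·w = −1 for the signed incidence
-- vector w of a tree walk from u to v; so w is not in the cone.

module Submission where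

open import Defs
open import Algebra.Bundles using (CommutativeRing)
open import Data.Empty using (⊥-elim)
open import Data.Fin using (Fin; zero; suc; _≟_)
open import Data.Fin.Properties using (any?)
open import Data.Fin.Subset using (Subset; ⁅_⁆; _∪_; _⊃_) renaming (_∈_ to _∈ˢ_)
open import Data.Fin.Subset.Induction using (⊃-wellFounded)
open import Data.Fin.Subset.Properties
  using (x∈⁅x⁆; x∈⁅y⁆⇒x≡y; p⊆p∪q; q⊆p∪q; x∈p∪q⁻) renaming (_∈?_ to _∈ˢ?_)
open import Data.List.Membership.Propositional using (_∈_; _∉_)
open import Data.List.Relation.Binary.Subset.Propositional using (_⊆_)
open import Data.List.Relation.Unary.All using ([]; lookup)
open import Data.List.Relation.Unary.All.Properties using (¬Any⇒All¬; anti-mono)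
open import Data.List.Relation.Unary.AllPairs using ([]; _∷_)
open import Data.List.Relation.Unary.Any using (here; there)
open import Data.List.Relation.Unary.Unique.Propositional using (Unique)
open import Data.Nat as ℕ using (ℕ)
import Data.Nat.Properties as ℕ
open import Data.Product using (∃; ∃₂; _×_; _,_; proj₁; proj₂)
open import Data.Rational as ℚ using (ℚ; 0ℚ; 1ℚ; ½; ∣_∣)
import Data.Rational.Properties as ℚ
open import Data.Rational.Solver using (module +-*-Solver)
open import Data.Sum using (_⊎_; inj₁; inj₂; [_,_]′)
open import Data.Unit using (tt)
open import Data.Vec.Functional using (Vector; foldr; replicate)
open import Function using (_∘_; id; case_of_)
open import Function.Bundles using (_⇔_; mk⇔)
open import Induction.WellFounded using (Acc; acc)
open import Level using (0ℓ)
open import Relation.Binary using (Rel)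
open import Relation.Binary.Construct.Closure.ReflexiveTransitive using (Star; ε; _◅_; _◅◅_)
open import Relation.Binary.Construct.Closure.Symmetric using (SymClosure; fwd; bwd; symmetric)
open import Relation.Binary.PropositionalEquality
open import Relation.Nullary using (¬_; yes; no; ¬?; _×-dec_; contradiction)
open import Relation.Unary using (Pred)

import Data.List.Membership.DecPropositional as DecMembership
open import Algebra.Properties.Semiring.Sum (CommutativeRing.semiring ℚ.+-*-commutativeRing)
open +-*-Solver

-- Walks, paths and loop erasure

module _ {A : Set} {R : Rel A 0ℓ} where

  start∈vertices : ∀ {u v} (w : Star R u v) → u ∈ vertices w
  start∈vertices ε       = here refl
  start∈vertices (_ ◅ _) = here refl

  end∈vertices : ∀ {u v} (w : Star R u v) → v ∈ vertices w
  end∈vertices ε       = here refl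
  end∈vertices (_ ◅ w) = there (end∈vertices w)

  vertices-prefix : ∀ {u v x} (p : Star R u v) (q : Star R v x) →
    vertices p ⊆ vertices (p ◅◅ q)
  vertices-prefix ε       q (here refl) = start∈vertices q
  vertices-prefix (_ ◅ p) q (here refl) = here refl
  vertices-prefix (_ ◅ p) q (there v∈p) = there (vertices-prefix p q v∈p)

  split-path : ∀ {u v x} (w : Star R u v) → Unique (vertices w) → x ∈ vertices w →
    ∃₂ λ (p : Star R u x) (q : Star R x v) →
      Unique (vertices p) × Unique (vertices q) × w ≡ p ◅◅ q
  split-path ε       uniq (here refl) = ε , ε , uniq , uniq , refl
  split-path (s ◅ w) uniq (here refl) = ε , s ◅ w , [] ∷ [] , uniq , refl
  split-path (s ◅ w) (u∉w ∷ uniq) (there x∈w) with split-path w uniq x∈w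
  ... | p , q , p-uniq , q-uniq , refl =
    s ◅ p , q , anti-mono (vertices-prefix p q) u∉w ∷ p-uniq , q-uniq , refl

  closed-path≡ε : ∀ {u} (p : Star R u u) → Unique (vertices p) → p ≡ ε
  closed-path≡ε ε       _         = refl
  closed-path≡ε (_ ◅ p) (u∉p ∷ _) = contradiction refl (lookup u∉p (end∈vertices p))

module _ {p} {R : Rel (Fin p) 0ℓ} where
  open DecMembership (_≟_ {p}) using (_∈?_)

  -- If `u` recurs on the erased tail, the part of that tail from `u` on is already a path from `u`.
  erase-loops : ∀ {u v} → Star R u v → ∃ λ (w : Star R u v) → Unique (vertices w)
  erase-loops ε = ε , [] ∷ []
  erase-loops {u} (s ◅ w) with erase-loops w
  ... | q , uniq with u ∈? vertices q
  ...   | no  u∉q = s ◅ q , ¬Any⇒All¬ _ u∉q ∷ uniq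
  ...   | yes u∈q = let _ , r , _ , r-uniq , _ = split-path q uniq u∈q in r , r-uniq

-- Sums with a single nonzero term

sum-single : ∀ {n} (f : Vector ℚ n) j → (∀ i → i ≢ j → f i ≡ 0ℚ) → sum f ≡ f j
sum-single {ℕ.suc n} f zero f≡0 = begin
  f zero ℚ.+ sum (f ∘ suc)          ≡⟨ cong (f zero ℚ.+_) (sum-cong-≗ (λ i → f≡0 (suc i) λ ())) ⟩
  f zero ℚ.+ sum (replicate n 0ℚ)   ≡⟨ cong (f zero ℚ.+_) (sum-replicate-zero n) ⟩
  f zero ℚ.+ 0ℚ                     ≡⟨ ℚ.+-identityʳ (f zero) ⟩
  f zero                            ∎
  where open ≡-Reasoning
sum-single f (suc j) f≡0 =
  trans (cong₂ ℚ._+_ (f≡0 zero λ ()) (sum-single (f ∘ suc) j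
           (λ i i≢j → f≡0 (suc i) λ { refl → i≢j refl })))
    (ℚ.+-identityˡ _)

-- Signed flow of a walk through an arc

sign : Direction → ℚ
sign forward  = 1ℚ
sign backward = ℚ.- 1ℚ

module _ {p m} (G : Digraph p m) where

  stepFlow : Fin m → ∀ {u v} → SymClosure (Arc G) u v → ℚ
  stepFlow i s with i ≟ stepArc G s
  ... | yes _ = sign (stepDirection G s)
  ... | no  _ = 0ℚ

  -- Every crossing counts, not just the first as in `traversal`; this makes the quantity additive
  -- under concatenation. `entry-traversal` shows that the two agree on paths.
  flow : Fin m → ∀ {u v} → Walk G u v → ℚ
  flow i ε       = 0ℚ
  flow i (s ◅ w) = stepFlow i s ℚ.+ flow i w

  flow-◅◅ : ∀ i {u v x} (w : Walk G u v) (w′ : Walk G v x) →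
    flow i (w ◅◅ w′) ≡ flow i w ℚ.+ flow i w′
  flow-◅◅ i ε       w′ = sym (ℚ.+-identityˡ _)
  flow-◅◅ i (s ◅ w) w′ =
    trans (cong (stepFlow i s ℚ.+_) (flow-◅◅ i w w′)) (sym (ℚ.+-assoc (stepFlow i s) _ _))

  stepFlow-symmetric : ∀ i {u v} (s : SymClosure (Arc G) u v) →
    stepFlow i (symmetric (Arc G) s) ≡ ℚ.- stepFlow i s
  stepFlow-symmetric i (fwd (j , _)) with i ≟ j
  ... | yes _ = refl
  ... | no  _ = refl
  stepFlow-symmetric i (bwd (j , _)) with i ≟ j
  ... | yes _ = refl
  ... | no  _ = refl

  ends∈vertices : ∀ {j u v} (w : Walk G u v) → j ∈ arcs G w →
    proj₁ (arc G j) ∈ vertices w × proj₂ (arc G j) ∈ vertices w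
  ends∈vertices (fwd (j , e) ◅ w) (here refl) rewrite e = here refl , there (start∈vertices w)
  ends∈vertices (bwd (j , e) ◅ w) (here refl) rewrite e = there (start∈vertices w) , here refl
  ends∈vertices (_ ◅ w) (there j∈w) =
    let src∈w , tgt∈w = ends∈vertices w j∈w in there src∈w , there tgt∈w

  stepEnds∈vertices : ∀ {u v x y} (s : SymClosure (Arc G) x y) (w : Walk G u v) →
    stepArc G s ∈ arcs G w → x ∈ vertices w × y ∈ vertices w
  stepEnds∈vertices (fwd (j , refl)) w j∈w = ends∈vertices w j∈w
  stepEnds∈vertices (bwd (j , refl)) w j∈w = let x , y = ends∈vertices w j∈w in y , x

  flow-absent : ∀ i {u v} (w : Walk G u v) → i ∉ arcs G w → flow i w ≡ 0ℚ
  flow-absent i ε       _   = refl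
  flow-absent i (s ◅ w) i∉w with i ≟ stepArc G s
  ... | yes i≡s = contradiction (here i≡s) i∉w
  ... | no  _   = trans (ℚ.+-identityˡ _) (flow-absent i w (i∉w ∘ there))

  -- A path never returns to the start of its first step. That vertex is an end of the step's arc,
  -- so the rest of the path does not use this arc and adds no flow through it.
  entry-traversal : ∀ i k {u v} (w : Walk G u v) → Unique (vertices w) →
    seq (entry (traversal G i w)) k ≡ flow i w
  entry-traversal i k ε       _ = refl
  entry-traversal i k (s ◅ w) (u∉w ∷ uniq) with i ≟ stepArc G s
  ... | no  _    = trans (entry-traversal i k w uniq) (sym (ℚ.+-identityˡ _))
  ... | yes refl
    rewrite flow-absent i w (λ s∈w → lookup u∉w (proj₁ (stepEnds∈vertices s w s∈w)) refl)
    with stepDirection G s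
  ...   | forward  = refl
  ...   | backward = refl

  -- Such a walk is a step followed by its reversal, because the arc of s can only be the
  -- first arc of p.
  retraced-flow : ∀ i {u x} (s : SymClosure (Arc G) u x) (p : Walk G x u) →
    Unique (vertices p) → stepArc G s ∈ arcs G p → flow i (s ◅ p) ≡ 0ℚ
  retraced-flow i s (t ◅ p) (x∉p ∷ _) (there s∈p) =
    contradiction refl (lookup x∉p (proj₂ (stepEnds∈vertices s p s∈p)))
  -- An arc crossed twice in a row in the same direction is a loop, so the remaining walk would end
  -- at `x`, which it must avoid.
  retraced-flow i (fwd (j , e)) (fwd (.j , e′) ◅ p) (x∉p ∷ _) (here refl)
    with refl ← trans (sym e) e′ = contradiction refl (lookup x∉p (end∈vertices p))
  retraced-flow i (bwd (j , e)) (bwd (.j , e′) ◅ p) (x∉p ∷ _) (here refl)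
    with refl ← trans (sym e) e′ = contradiction refl (lookup x∉p (end∈vertices p))
  retraced-flow i (fwd (j , e)) (bwd (.j , e′) ◅ p) (_ ∷ uniq) (here refl)
    with refl ← trans (sym e) e′ with refl ← closed-path≡ε p uniq with i ≟ j
  ... | yes _ = refl
  ... | no  _ = refl
  retraced-flow i (bwd (j , e)) (fwd (.j , e′) ◅ p) (_ ∷ uniq) (here refl)
    with refl ← trans (sym e) e′ with refl ← closed-path≡ε p uniq with i ≟ j
  ... | yes _ = refl
  ... | no  _ = refl

  arcs-unique : ∀ {u v} (w : Walk G u v) → Unique (vertices w) → Unique (arcs G w)
  arcs-unique ε       _ = []
  arcs-unique (s ◅ w) (u∉w ∷ uniq) =
    ¬Any⇒All¬ _ (λ s∈w → lookup u∉w (proj₁ (stepEnds∈vertices s w s∈w)) refl)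
      ∷ arcs-unique w uniq

  -- Flow in an acyclic digraph

  module _ (acyclic : Acyclic G) where
    open DecMembership (_≟_ {p}) using () renaming (_∈?_ to _∈ᵛ?_)
    open DecMembership (_≟_ {m}) using () renaming (_∈?_ to _∈ᵃ?_)

    -- Loop erasure that keeps track of the flow. The closed walk `s ◅ q₁` to be erased cannot be a
    -- cycle, so `q₁` uses the arc of `s` again; by `retraced-flow` erasing it changes no flow.
    path-with-flow : ∀ {u v} (w : Walk G u v) →
      ∃ λ (q : Walk G u v) → Unique (vertices q) × (∀ i → flow i q ≡ flow i w)
    path-with-flow ε = ε , [] ∷ [] , λ _ → refl
    path-with-flow {u} (s ◅ w) with path-with-flow w
    ... | q , uniq , q≡w with u ∈ᵛ? vertices q
    ...   | no  u∉q = s ◅ q , ¬Any⇒All¬ _ u∉q ∷ uniq , λ i → cong (stepFlow i s ℚ.+_) (q≡w i)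
    ...   | yes u∈q with split-path q uniq u∈q
    ...     | q₁ , q₂ , q₁-uniq , q₂-uniq , refl with stepArc G s ∈ᵃ? arcs G q₁
    ...       | no  s∉q₁ = contradiction
                (q₁-uniq , ¬Any⇒All¬ _ s∉q₁ ∷ arcs-unique q₁ q₁-uniq) (acyclic (s ◅ q₁))
    ...       | yes s∈q₁ = q₂ , q₂-uniq , λ i → begin
      flow i q₂                          ≡⟨ ℚ.+-identityˡ _ ⟨
      0ℚ ℚ.+ flow i q₂
        ≡⟨ cong (ℚ._+ flow i q₂) (retraced-flow i s q₁ q₁-uniq s∈q₁) ⟨
      flow i (s ◅ q₁) ℚ.+ flow i q₂      ≡⟨ flow-◅◅ i (s ◅ q₁) q₂ ⟨
      stepFlow i s ℚ.+ flow i (q₁ ◅◅ q₂) ≡⟨ cong (stepFlow i s ℚ.+_) (q≡w i) ⟩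
      flow i (s ◅ w)                     ∎
      where open ≡-Reasoning

    -- Steps of `w` are moved, reversed, to the front of `w′` until `w` is empty. Then `w′` is
    -- closed, and the path with the same flow can only be `ε`.
    flow-unique : ∀ i {u v} (w w′ : Walk G u v) → flow i w ≡ flow i w′
    flow-unique i ε w′ with path-with-flow w′
    ... | q , uniq , q≡w′ with refl ← closed-path≡ε q uniq = q≡w′ i
    flow-unique i (s ◅ w) w′ = begin
      f ℚ.+ flow i w                         ≡⟨ cong (f ℚ.+_) (flow-unique i w (s⁻¹ ◅ w′)) ⟩
      f ℚ.+ (stepFlow i s⁻¹ ℚ.+ flow i w′)
        ≡⟨ cong (λ g → f ℚ.+ (g ℚ.+ flow i w′)) (stepFlow-symmetric i s) ⟩
      f ℚ.+ (ℚ.- f ℚ.+ flow i w′)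
        ≡⟨ solve 2 (λ f g → f :+ (:- f :+ g) := g) refl f (flow i w′) ⟩
      flow i w′                              ∎
      where
      open ≡-Reasoning
      f = stepFlow i s
      s⁻¹ = symmetric (Arc G) s

  -- Reachable sets and cuts

  -- An invariant for growing a set from `u`: it may still be too small. It is the whole reachable
  -- set once it is also `ArcClosed`.
  Reached : Fin p → Subset p → Set
  Reached u S = u ∈ˢ S × (∀ {x} → x ∈ˢ S → DirectedWalk G u x)

  ArcClosed : Subset p → Set
  ArcClosed S = ∀ j → proj₁ (arc G j) ∈ˢ S → proj₂ (arc G j) ∈ˢ S

  -- As long as some arc leaves `S`, its head is added; strict growth inside a finite vertex set
  -- terminates.
  saturate : ∀ {u} S → Acc _⊃_ S → Reached u S → ∃ λ S′ → Reached u S′ × ArcClosed S′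
  saturate {u} S (acc rec) (u∈S , reach)
    with any? (λ j → (proj₁ (arc G j) ∈ˢ? S) ×-dec ¬? (proj₂ (arc G j) ∈ˢ? S))
  ... | no  none = S , (u∈S , reach) , closed
    where
    closed : ArcClosed S
    closed j src∈S with proj₂ (arc G j) ∈ˢ? S
    ... | yes tgt∈S = tgt∈S
    ... | no  tgt∉S = contradiction (j , src∈S , tgt∉S) none
  ... | yes (j , src∈S , tgt∉S) =
    saturate (S ∪ ⁅ t ⁆)
      (rec ((λ {x} → p⊆p∪q ⁅ t ⁆ {x}) , t , q⊆p∪q S ⁅ t ⁆ (x∈⁅x⁆ t) , tgt∉S))
      (p⊆p∪q ⁅ t ⁆ u∈S , λ x∈ → [ reach , reach-t ]′ (x∈p∪q⁻ S ⁅ t ⁆ x∈))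
    where
    t = proj₂ (arc G j)
    reach-t : ∀ {x} → x ∈ˢ ⁅ t ⁆ → DirectedWalk G u x
    reach-t x∈ with refl ← x∈⁅y⁆⇒x≡y t x∈ = reach src∈S ◅◅ (j , refl) ◅ ε

  reachable : ∀ u → ∃ λ S → Reached u S × ArcClosed S
  reachable u = saturate ⁅ u ⁆ (⊃-wellFounded _)
    (x∈⁅x⁆ u , λ x∈ → case x∈⁅y⁆⇒x≡y u x∈ of λ { refl → ε })

  -- Membership in the saturated set is decidable, so the alternative holds constructively, with a
  -- cut as the certificate of unreachability.
  path-or-cut : ∀ u v →
    DirectedPath G u v ⊎ ∃ λ S → ArcClosed S × u ∈ˢ S × ¬ v ∈ˢ S
  path-or-cut u v with reachable u
  ... | S , (u∈S , reach) , closed with v ∈ˢ? S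
  ...   | yes v∈S = inj₁ (erase-loops (reach v∈S))
  ...   | no  v∉S = inj₂ (S , closed , u∈S , v∉S)

  -- Potentials and gradients

  stepFlow-stepArc : ∀ {u v} (s : SymClosure (Arc G) u v) →
    stepFlow (stepArc G s) s ≡ sign (stepDirection G s)
  stepFlow-stepArc s with stepArc G s ≟ stepArc G s
  ... | yes _  = refl
  ... | no s≢s = contradiction refl s≢s

  stepFlow-other : ∀ {i u v} (s : SymClosure (Arc G) u v) → i ≢ stepArc G s → stepFlow i s ≡ 0ℚ
  stepFlow-other {i} s i≢s with i ≟ stepArc G s
  ... | yes i≡s = contradiction i≡s i≢s
  ... | no  _   = refl

  module _ (φ : Fin p → ℚ) where

    gradient : Vector ℚ m
    gradient j = φ (proj₂ (arc G j)) ℚ.- φ (proj₁ (arc G j))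

    gradient-step : ∀ {u v} (s : SymClosure (Arc G) u v) →
      gradient (stepArc G s) ℚ.* sign (stepDirection G s) ≡ φ v ℚ.- φ u
    gradient-step (fwd (j , refl)) = ℚ.*-identityʳ _
    gradient-step (bwd (j , refl)) =
      solve 2 (λ a b → (a :- b) :* (:- con 1ℚ) := b :- a) refl
        (φ (proj₂ (arc G j))) (φ (proj₁ (arc G j)))

    -- A telescoping sum: each step contributes the potential difference across it, the sign of the
    -- flow correcting for arcs crossed backward.
    ∑-gradient-flow : ∀ {u v} (w : Walk G u v) →
      ∑[ i < m ] (gradient i ℚ.* flow i w) ≡ φ v ℚ.- φ u
    ∑-gradient-flow {u} ε = begin
      ∑[ i < m ] (gradient i ℚ.* 0ℚ)  ≡⟨ sum-cong-≗ (λ i → ℚ.*-zeroʳ (gradient i)) ⟩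
      sum (replicate m 0ℚ)            ≡⟨ sum-replicate-zero m ⟩
      0ℚ                              ≡⟨ ℚ.+-inverseʳ (φ u) ⟨
      φ u ℚ.- φ u                     ∎
      where open ≡-Reasoning
    ∑-gradient-flow {u} {v} (_◅_ {j = x} s w) = begin
      ∑[ i < m ] (gradient i ℚ.* (stepFlow i s ℚ.+ flow i w))
        ≡⟨ sum-cong-≗ (λ i → ℚ.*-distribˡ-+ (gradient i) (stepFlow i s) (flow i w)) ⟩
      ∑[ i < m ] (gradient i ℚ.* stepFlow i s ℚ.+ gradient i ℚ.* flow i w)
        ≡⟨ ∑-distrib-+ (λ i → gradient i ℚ.* stepFlow i s) (λ i → gradient i ℚ.* flow i w) ⟩
      ∑[ i < m ] (gradient i ℚ.* stepFlow i s) ℚ.+ ∑[ i < m ] (gradient i ℚ.* flow i w)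
        ≡⟨ cong₂ ℚ._+_ at-step (∑-gradient-flow w) ⟩
      (φ x ℚ.- φ u) ℚ.+ (φ v ℚ.- φ x)
        ≡⟨ solve 3 (λ a b c → (b :- a) :+ (c :- b) := c :- a) refl (φ u) (φ x) (φ v) ⟩
      φ v ℚ.- φ u ∎
      where
      open ≡-Reasoning
      at-step : ∑[ i < m ] (gradient i ℚ.* stepFlow i s) ≡ φ x ℚ.- φ u
      at-step = begin
        ∑[ i < m ] (gradient i ℚ.* stepFlow i s)
          ≡⟨ sum-single _ (stepArc G s) (λ i i≢s →
               trans (cong (gradient i ℚ.*_) (stepFlow-other s i≢s)) (ℚ.*-zeroʳ (gradient i))) ⟩
        gradient (stepArc G s) ℚ.* stepFlow (stepArc G s) s
          ≡⟨ cong (gradient (stepArc G s) ℚ.*_) (stepFlow-stepArc s) ⟩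
        gradient (stepArc G s) ℚ.* sign (stepDirection G s)
          ≡⟨ gradient-step s ⟩
        φ x ℚ.- φ u ∎

-- Nonnegativity of rational sequences and reals

-- The sequence is eventually above −δ for every δ > 0; for x : ℝ,
-- EventuallyNonNeg (seq x) is 0ℝ ≤ x.
EventuallyNonNeg : Pred (ℕ → ℚ) 0ℓ
EventuallyNonNeg f = ∀ δ → 0ℚ ℚ.< δ → ∃ λ N → ∀ k → N ℕ.≤ k → 0ℚ ℚ.< f k ℚ.+ δ

const-nonNeg : ∀ {q} → 0ℚ ℚ.≤ q → EventuallyNonNeg (λ _ → q)
const-nonNeg q≥0 δ δ>0 = 0 , λ _ _ → ℚ.+-mono-≤-< q≥0 δ>0

+-nonNeg : ∀ f g → EventuallyNonNeg f → EventuallyNonNeg g →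
  EventuallyNonNeg (λ k → f k ℚ.+ g k)
+-nonNeg f g f≥0 g≥0 δ δ>0 =
  let γ>0 = ℚ.<-respˡ-≡ (ℚ.*-zeroʳ ½) (ℚ.*-monoʳ-<-pos ½ δ>0)
      M , hf = f≥0 (½ ℚ.* δ) γ>0
      N , hg = g≥0 (½ ℚ.* δ) γ>0
  in M ℕ.⊔ N , λ k k≥ →
       ℚ.<-respʳ-≡
         (solve 3 (λ a b d → (a :+ con ½ :* d) :+ (b :+ con ½ :* d) := (a :+ b) :+ d)
           refl (f k) (g k) δ)
         (ℚ.+-mono-< (hf k (ℕ.m⊔n≤o⇒m≤o M N k≥)) (hg k (ℕ.m⊔n≤o⇒n≤o M N k≥)))

∑-nonNeg : ∀ {n} (f : Fin n → ℕ → ℚ) → (∀ i → EventuallyNonNeg (f i)) →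
  EventuallyNonNeg (λ k → ∑[ i < n ] f i k)
∑-nonNeg {ℕ.zero}  f f≥0 = const-nonNeg ℚ.≤-refl
∑-nonNeg {ℕ.suc n} f f≥0 = +-nonNeg (f zero) _ (f≥0 zero) (∑-nonNeg (f ∘ suc) (f≥0 ∘ suc))

-- Gradients of indicators of arc-closed sets take only the values 0 and 1, and for these the same δ
-- serves without rescaling.
0-1-*-nonNeg : ∀ {c} f → c ≡ 0ℚ ⊎ c ≡ 1ℚ → EventuallyNonNeg f →
  EventuallyNonNeg (λ k → c ℚ.* f k)
0-1-*-nonNeg f (inj₁ refl) f≥0 δ δ>0 =
  0 , λ k _ → subst (λ q → 0ℚ ℚ.< q ℚ.+ δ) (sym (ℚ.*-zeroˡ (f k)))
    (ℚ.<-respʳ-≡ (sym (ℚ.+-identityˡ δ)) δ>0)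
0-1-*-nonNeg f (inj₂ refl) f≥0 δ δ>0 =
  let N , h = f≥0 δ δ>0 in
  N , λ k k≥ → subst (λ q → 0ℚ ℚ.< q ℚ.+ δ) (sym (ℚ.*-identityˡ (f k))) (h k k≥)

p≤∣p∣ : ∀ p → p ℚ.≤ ∣ p ∣
p≤∣p∣ p with ℚ.≤-total 0ℚ p
... | inj₁ 0≤p = ℚ.≤-reflexive (sym (ℚ.0≤p⇒∣p∣≡p 0≤p))
... | inj₂ p≤0 = ℚ.≤-trans p≤0 (ℚ.0≤∣p∣ p)

∣p-q∣<r⇒0<q-p+r : ∀ {p q r} → ∣ p ℚ.- q ∣ ℚ.< r → 0ℚ ℚ.< (q ℚ.- p) ℚ.+ r
∣p-q∣<r⇒0<q-p+r {p} {q} {r} h =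
  subst₂ ℚ._<_ (ℚ.+-inverseʳ (p ℚ.- q))
    (solve 3 (λ p q r → r :- (p :- q) := (q :- p) :+ r) refl p q r)
    (ℚ.+-monoˡ-< (ℚ.- (p ℚ.- q)) (ℚ.≤-<-trans (p≤∣p∣ (p ℚ.- q)) h))

≃⇒nonNeg : ∀ {x y} → x ≃ y → EventuallyNonNeg (λ k → seq y k ℚ.- seq x k)
≃⇒nonNeg {x} x≃y δ δ>0 =
  let N , h = x≃y δ δ>0 in N , λ k k≥ → ∣p-q∣<r⇒0<q-p+r {seq x k} (h k k≥)

seq-≗⇒≃ : ∀ {x y} → (∀ k → seq x k ≡ seq y k) → x ≃ y
seq-≗⇒≃ {x} {y} x≗y δ δ>0 = 0 , λ k _ →
  ℚ.<-respˡ-≡ (sym (cong ∣_∣ (trans (cong (ℚ._- seq y k) (x≗y k)) (ℚ.+-inverseʳ (seq y k))))) δ>0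

-- This allows a real to be written as a difference of nonnegative reals without deciding its sign.
-- Beyond `N` the terms exceed `a` - 1, so adding 1 + ∣ `a` ∣ makes them positive.
bounded-below : ∀ x → ∃ λ c → 0ℝ ≤ fromℚ c × 0ℝ ≤ x + fromℚ c
bounded-below x =
  let N , near = cauchy x 1ℚ (ℚ.positive⁻¹ 1ℚ)
      a = seq x N
  in  1ℚ ℚ.+ ∣ a ∣
    , const-nonNeg (ℚ.+-mono-≤ (ℚ.nonNegative⁻¹ 1ℚ) (ℚ.0≤∣p∣ a))
    , λ δ δ>0 → N , λ k k≥ → ℚ.<-respʳ-≡
        (solve 4 (λ a b c δ → (((b :- a) :+ con 1ℚ) :+ (a :+ c)) :+ δ := (b :+ (con 1ℚ :+ c)) :+ δ)
          refl a (seq x k) ∣ a ∣ δ)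
        (ℚ.+-mono-<
          (ℚ.+-mono-<-≤ (∣p-q∣<r⇒0<q-p+r {a} (near N k ℕ.≤-refl k≥)) (0≤p+∣p∣ a)) δ>0)
  where
  0≤p+∣p∣ : ∀ p → 0ℚ ℚ.≤ p ℚ.+ ∣ p ∣
  0≤p+∣p∣ p = subst₂ ℚ._≤_ (ℚ.+-inverseʳ p)
    (cong (p ℚ.+_) (ℚ.∣-p∣≡∣p∣ p)) (ℚ.+-monoʳ-≤ p (p≤∣p∣ (ℚ.- p)))

-- Matrix products and the cone of the columns

seq-foldr-+ : ∀ {n} (v : Vector ℝ n) k → seq (foldr _+_ 0ℝ v) k ≡ ∑[ i < n ] seq (v i) k
seq-foldr-+ {ℕ.zero}  v k = refl
seq-foldr-+ {ℕ.suc n} v k = cong (seq (v zero) k ℚ.+_) (seq-foldr-+ (v ∘ suc) k)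

module _ {n m} (D : Matrix n m) where

  seq-*ᵥ : ∀ x i k → seq ((D *ᵥ x) i) k ≡ ∑[ j < m ] (seq (D i j) k ℚ.* seq (x j) k)
  seq-*ᵥ x i k = seq-foldr-+ (λ j → D i j * x j) k

  -- A variant of `pspan` whose equations hold term by term on representing sequences instead of up
  -- to `_≃_`, so that its closure properties are identities between rationals.
  Cone : Pred (Fin n → ℕ → ℚ) 0ℓ
  Cone f = ∃ λ (x : Vector ℝ m) → (∀ j → 0ℝ ≤ x j) ×
    (∀ i k → ∑[ j < m ] (seq (D i j) k ℚ.* seq (x j) k) ≡ f i k)

  cone-resp : ∀ {f g} → (∀ i k → f i k ≡ g i k) → Cone f → Cone g
  cone-resp f≗g (x , x≥0 , Dx≡f) = x , x≥0 , λ i k → trans (Dx≡f i k) (f≗g i k)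

  cone-0 : Cone (λ _ _ → 0ℚ)
  cone-0 = replicate m 0ℝ , (λ _ → const-nonNeg ℚ.≤-refl) , λ i k →
    trans (sum-cong-≗ (λ j → ℚ.*-zeroʳ (seq (D i j) k))) (sum-replicate-zero m)

  cone-+ : ∀ {f g} → Cone f → Cone g → Cone (λ i k → f i k ℚ.+ g i k)
  cone-+ (x , x≥0 , Dx≡f) (y , y≥0 , Dy≡g) =
    (λ j → x j + y j) , (λ j → +-nonNeg (seq (x j)) (seq (y j)) (x≥0 j) (y≥0 j)) , λ i k →
      trans (sum-cong-≗ (λ j → ℚ.*-distribˡ-+ (seq (D i j) k) (seq (x j) k) (seq (y j) k)))
        (trans (∑-distrib-+ (λ j → seq (D i j) k ℚ.* seq (x j) k) _)
          (cong₂ ℚ._+_ (Dx≡f i k) (Dy≡g i k)))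

  cone-∑ : ∀ {l} (f : Fin l → Fin n → ℕ → ℚ) → (∀ a → Cone (f a)) →
    Cone (λ i k → ∑[ a < l ] f a i k)
  cone-∑ {ℕ.zero}  f f∈ = cone-0
  cone-∑ {ℕ.suc l} f f∈ = cone-+ (f∈ zero) (cone-∑ (f ∘ suc) (f∈ ∘ suc))

  cone-column : ∀ j {r} → 0ℝ ≤ r → Cone (λ i k → seq (D i j) k ℚ.* seq r k)
  cone-column j {r} r≥0 = x , x≥0 , λ i k →
    trans (sum-single _ j (λ j′ j′≢j →
            trans (cong (seq (D i j′) k ℚ.*_) (x-off j′≢j k)) (ℚ.*-zeroʳ (seq (D i j′) k))))
      (cong (seq (D i j) k ℚ.*_) (x-on k))
    where
    x : Vector ℝ m
    x j′ with j′ ≟ j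
    ... | yes _ = r
    ... | no  _ = 0ℝ
    x≥0 : ∀ j′ → 0ℝ ≤ x j′
    x≥0 j′ with j′ ≟ j
    ... | yes _ = r≥0
    ... | no  _ = const-nonNeg ℚ.≤-refl
    x-on : ∀ k → seq (x j) k ≡ seq r k
    x-on k with j ≟ j
    ... | yes _  = refl
    ... | no j≢j = contradiction refl j≢j
    x-off : ∀ {j′} → j′ ≢ j → ∀ k → seq (x j′) k ≡ 0ℚ
    x-off {j′} j′≢j k with j′ ≟ j
    ... | yes j′≡j = contradiction j′≡j j′≢j
    ... | no  _    = refl

-- Separation from the cone

-- In `separation` the product D x equals w only up to `_≃_`; the error w - D x is kept as a
-- separate, eventually nonnegative summand, which this identity absorbs.
∑-*-difference : ∀ {n} (y a b : Vector ℚ n) →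
  ∑[ i < n ] (y i ℚ.* a i) ℚ.+ ∑[ i < n ] (y i ℚ.* (b i ℚ.- a i)) ≡ ∑[ i < n ] (y i ℚ.* b i)
∑-*-difference y a b = trans
  (sym (∑-distrib-+ (λ i → y i ℚ.* a i) (λ i → y i ℚ.* (b i ℚ.- a i))))
  (sum-cong-≗ λ i → solve 3 (λ y a b → y :* a :+ y :* (b :- a) := y :* b) refl (y i) (a i) (b i))

∑-transpose : ∀ {n m} (y : Vector ℚ n) (A : Fin n → Fin m → ℚ) (x : Vector ℚ m) →
  ∑[ j < m ] (∑[ i < n ] (y i ℚ.* A i j) ℚ.* x j) ≡ ∑[ i < n ] (y i ℚ.* ∑[ j < m ] (A i j ℚ.* x j))
∑-transpose {n} {m} y A x = begin
  ∑[ j < m ] (∑[ i < n ] (y i ℚ.* A i j) ℚ.* x j)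
    ≡⟨ sum-cong-≗ (λ j → *-distribʳ-sum (x j) (λ i → y i ℚ.* A i j)) ⟩
  ∑[ j < m ] ∑[ i < n ] (y i ℚ.* A i j ℚ.* x j)
    ≡⟨ ∑-comm (λ j i → y i ℚ.* A i j ℚ.* x j) ⟩
  ∑[ i < n ] ∑[ j < m ] (y i ℚ.* A i j ℚ.* x j)
    ≡⟨ sum-cong-≗ (λ i → sum-cong-≗ (λ j → ℚ.*-assoc (y i) (A i j) (x j))) ⟩
  ∑[ i < n ] ∑[ j < m ] (y i ℚ.* (A i j ℚ.* x j))
    ≡⟨ sum-cong-≗ (λ i → *-distribˡ-sum (y i) (λ j → A i j ℚ.* x j)) ⟨
  ∑[ i < n ] (y i ℚ.* ∑[ j < m ] (A i j ℚ.* x j)) ∎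
  where open ≡-Reasoning

-- If D x = w with x ≥ 0, then 0 ≤ (y·D)·x = y·w = −1.
separation : ∀ {n m} (D : Matrix n m) (y : Vector ℚ n) (c : Vector ℚ m) (w : Vector ℚ n) →
  (∀ i → y i ≡ 0ℚ ⊎ y i ≡ 1ℚ) → (∀ j → c j ≡ 0ℚ ⊎ c j ≡ 1ℚ) →
  (∀ j k → ∑[ i < n ] (y i ℚ.* seq (D i j) k) ≡ c j) →
  ∑[ i < n ] (y i ℚ.* w i) ≡ 0ℚ ℚ.- 1ℚ →
  ¬ pspan D (fromℚ ∘ w)
separation {n} {m} D y c w y-0-1 c-0-1 yD≡c yw≡-1 (x , x≥0 , Dx≃w) =
  -- The total is constantly -1, so tolerance 1 already gives the absurd 0 < -1 + 1.
  let N , above = nonNeg 1ℚ (ℚ.positive⁻¹ 1ℚ)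
  in ℚ.<-irrefl refl (subst (λ q → 0ℚ ℚ.< q ℚ.+ 1ℚ) (total N) (above N ℕ.≤-refl))
  where
  total : ∀ k → ∑[ j < m ] (c j ℚ.* seq (x j) k)
                  ℚ.+ ∑[ i < n ] (y i ℚ.* (w i ℚ.- seq ((D *ᵥ x) i) k))
                ≡ 0ℚ ℚ.- 1ℚ
  total k = trans (cong (ℚ._+ ∑[ i < n ] (y i ℚ.* (w i ℚ.- seq ((D *ᵥ x) i) k))) cx≡yDx)
    (trans (∑-*-difference y (λ i → seq ((D *ᵥ x) i) k) w) yw≡-1)
    where
    cx≡yDx : ∑[ j < m ] (c j ℚ.* seq (x j) k) ≡ ∑[ i < n ] (y i ℚ.* seq ((D *ᵥ x) i) k)
    cx≡yDx = trans (sym (sum-cong-≗ (λ j → cong (ℚ._* seq (x j) k) (yD≡c j k))))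
      (trans (∑-transpose y (λ i j → seq (D i j) k) (λ j → seq (x j) k))
        (sym (sum-cong-≗ (λ i → cong (y i ℚ.*_) (seq-*ᵥ D x i k)))))

  nonNeg : EventuallyNonNeg (λ k → ∑[ j < m ] (c j ℚ.* seq (x j) k)
                                     ℚ.+ ∑[ i < n ] (y i ℚ.* (w i ℚ.- seq ((D *ᵥ x) i) k)))
  nonNeg = +-nonNeg
    (λ k → ∑[ j < m ] (c j ℚ.* seq (x j) k))
    (λ k → ∑[ i < n ] (y i ℚ.* (w i ℚ.- seq ((D *ᵥ x) i) k)))
    (∑-nonNeg (λ j k → c j ℚ.* seq (x j) k) λ j →
      0-1-*-nonNeg (seq (x j)) (c-0-1 j) (x≥0 j))
    (∑-nonNeg (λ i k → y i ℚ.* (w i ℚ.- seq ((D *ᵥ x) i) k)) λ i →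
      0-1-*-nonNeg (λ k → w i ℚ.- seq ((D *ᵥ x) i) k) (y-0-1 i)
        (≃⇒nonNeg {(D *ᵥ x) i} {fromℚ (w i)} (Dx≃w i)))

pss-∋ : ∀ {n m} (D : Matrix n m) → IsPositiveSpanningSet D (ℝ^ n) → ∀ w → pspan D w
pss-∋ D (_ , ∋) w = ∋ {w} tt

-- Indicators of arc-closed sets

module _ {p} (S : Subset p) where

  indicator : Fin p → ℚ
  indicator x with x ∈ˢ? S
  ... | yes _ = 1ℚ
  ... | no  _ = 0ℚ

  indicator-crossing : ∀ {x y} → x ∈ˢ S → ¬ y ∈ˢ S →
    indicator y ℚ.- indicator x ≡ 0ℚ ℚ.- 1ℚ
  indicator-crossing {x} {y} x∈S y∉S with x ∈ˢ? S | y ∈ˢ? S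
  ... | yes _   | no  _   = refl
  ... | no  x∉S | _       = contradiction x∈S x∉S
  ... | yes _   | yes y∈S = contradiction y∈S y∉S

  -- The remaining value -1 would need an arc leaving `S`. Arcs of the tree are covered too, through
  -- `arcs⊆`.
  indicator-gradient : ∀ {m} (G : Digraph p m) → ArcClosed G S → ∀ {x y} → Arc G x y →
    indicator y ℚ.- indicator x ≡ 0ℚ ⊎ indicator y ℚ.- indicator x ≡ 1ℚ
  indicator-gradient G closed {x} {y} (j , e) with x ∈ˢ? S | y ∈ˢ? S
  ... | yes _   | yes _   = inj₁ refl
  ... | no  _   | yes _   = inj₂ refl
  ... | no  _   | no  _   = inj₁ refl
  ... | yes x∈S | no  y∉S with refl ← e = contradiction (closed j x∈S) y∉S

-- Network matrices and strong connectivity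

module _ {p m n} (G : Digraph p m) (T : Digraph p n) (T-span : IsOrientedSpanningTree G T) where
  open IsOrientedSpanningTree T-span

  private
    treePath : ∀ j → Path T (proj₁ (arc G j)) (proj₂ (arc G j))
    treePath j = proj₁ tree _ _

  networkMatrix-flow : ∀ i j k →
    seq (networkMatrix G T T-span i j) k ≡ flow T i (proj₁ (treePath j))
  networkMatrix-flow i j k = entry-traversal T i k (proj₁ (treePath j)) (proj₂ (treePath j))

  -- By induction on the directed walk: the column of its first arc is the flow of the tree path
  -- `q`, the rest is represented by `t′`, and `flow-unique` replaces `q ◅◅ t′` by the given `t`.
  walk∈cone : ∀ {u v r} → 0ℝ ≤ r → DirectedWalk G u v → (t : Walk T u v) →
    Cone (networkMatrix G T T-span) (λ i k → flow T i t ℚ.* seq r k)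
  walk∈cone {r = r} r≥0 ε t = cone-resp (networkMatrix G T T-span)
    (λ i k → trans (sym (ℚ.*-zeroˡ (seq r k)))
               (cong (ℚ._* seq r k) (flow-unique T (proj₂ tree) i ε t)))
    (cone-0 (networkMatrix G T T-span))
  walk∈cone {u} {v} {r} r≥0 (_◅_ {j = x} (j , refl) d) t = cone-resp (networkMatrix G T T-span)
    (λ i k → trans
      (cong (λ q → q ℚ.* seq r k ℚ.+ flow T i t′ ℚ.* seq r k) (networkMatrix-flow i j k))
      (trans (sym (ℚ.*-distribʳ-+ (seq r k) (flow T i q) (flow T i t′)))
        (cong (ℚ._* seq r k) (trans (sym (flow-◅◅ T i q t′))
          (flow-unique T (proj₂ tree) i (q ◅◅ t′) t)))))
    (cone-+ (networkMatrix G T T-span)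
      (cone-column (networkMatrix G T T-span) j {r} r≥0)
      (walk∈cone {r = r} r≥0 d t′))
    where
    q = proj₁ (treePath j)
    t′ = proj₁ (proj₁ tree x v)

  stronglyConnected⇒pss : StronglyConnected G →
    IsPositiveSpanningSet (networkMatrix G T T-span) (ℝ^ n)
  stronglyConnected⇒pss strong = (λ _ → tt) , λ {w} _ →
    let x , x≥0 , Mx≡w = w∈cone w
    in x , x≥0 , λ i → seq-≗⇒≃ {(networkMatrix G T T-span *ᵥ x) i} {w i}
      (λ k → trans (seq-*ᵥ (networkMatrix G T T-span) x i k) (Mx≡w i k))
    where
    fwdStep : ∀ a → SymClosure (Arc T) (proj₁ (arc T a)) (proj₂ (arc T a))
    fwdStep a = fwd (a , refl)
    bwdStep : ∀ a → SymClosure (Arc T) (proj₂ (arc T a)) (proj₁ (arc T a))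
    bwdStep a = bwd (a , refl)

    -- w is the sum over a of (w_a + c_a) e_a and of c_a (− e_a), with c_a and
    -- w_a + c_a nonnegative.
    w∈cone : ∀ w → Cone (networkMatrix G T T-span) (λ i k → seq (w i) k)
    w∈cone w = cone-resp (networkMatrix G T T-span) sum≡w
      (cone-∑ (networkMatrix G T T-span) summand λ a → cone-+ (networkMatrix G T T-span)
        -- For e_a the directed walk is the tree arc itself, which belongs to `G`; for -e_a strong
        -- connectivity supplies a walk from its head back to its tail.
        (walk∈cone {r = w a + fromℚ (c a)} (w+c≥0 a) (arcs⊆ (a , refl) ◅ ε) (fwdStep a ◅ ε))
        (walk∈cone {r = fromℚ (c a)} (c≥0 a) (proj₁ (strong _ _)) (bwdStep a ◅ ε)))
      where
      c : Fin n → ℚ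
      c a = proj₁ (bounded-below (w a))
      c≥0 : ∀ a → 0ℝ ≤ fromℚ (c a)
      c≥0 a = proj₁ (proj₂ (bounded-below (w a)))
      w+c≥0 : ∀ a → 0ℝ ≤ w a + fromℚ (c a)
      w+c≥0 a = proj₂ (proj₂ (bounded-below (w a)))
      summand : Fin n → Fin n → ℕ → ℚ
      summand a i k = flow T i (fwdStep a ◅ ε) ℚ.* (seq (w a) k ℚ.+ c a)
                        ℚ.+ flow T i (bwdStep a ◅ ε) ℚ.* c a
      sum≡w : ∀ i k → ∑[ a < n ] summand a i k ≡ seq (w i) k
      sum≡w i k = trans (sum-single _ i off) on
        where
        off : ∀ a → a ≢ i → summand a i k ≡ 0ℚ
        off a a≢i
          rewrite stepFlow-other T (fwdStep a) (a≢i ∘ sym)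
                | stepFlow-other T (bwdStep a) (a≢i ∘ sym) =
          solve 2 (λ x c → (con 0ℚ :+ con 0ℚ) :* (x :+ c) :+ (con 0ℚ :+ con 0ℚ) :* c := con 0ℚ)
            refl (seq (w a) k) (c a)
        on : summand i i k ≡ seq (w i) k
        on rewrite stepFlow-stepArc T (fwdStep i) | stepFlow-stepArc T (bwdStep i) =
          solve 2 (λ x c → (con 1ℚ :+ con 0ℚ) :* (x :+ c) :+ (:- con 1ℚ :+ con 0ℚ) :* c := x)
            refl (seq (w i) k) (c i)

  cut-obstruction : ∀ {u v S} → ArcClosed G S → u ∈ˢ S → ¬ v ∈ˢ S → (t : Walk T u v) →
    ¬ pspan (networkMatrix G T T-span) (λ i → fromℚ (flow T i t))
  cut-obstruction {u} {v} {S} closed u∈S v∉S t = separation (networkMatrix G T T-span)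
    (gradient T (indicator S))
    (gradient G (indicator S))
    (λ i → flow T i t)
    (λ i → indicator-gradient S G closed (arcs⊆ (i , refl)))
    (λ j → indicator-gradient S G closed (j , refl))
    -- Column j is the flow of a tree path between the ends of arc j of `G`, so its pairing with the
    -- tree gradient telescopes to the gradient along that arc.
    (λ j k → trans
      (sum-cong-≗ (λ i → cong (gradient T (indicator S) i ℚ.*_) (networkMatrix-flow i j k)))
      (∑-gradient-flow T (indicator S) (proj₁ (treePath j))))
    (trans (∑-gradient-flow T (indicator S) t)
      (indicator-crossing S u∈S v∉S))

  pss⇒stronglyConnected : IsPositiveSpanningSet (networkMatrix G T T-span) (ℝ^ n) →
    StronglyConnected G
  pss⇒stronglyConnected pss u v =
    [ id
    , (λ (S , closed , u∈S , v∉S) → ⊥-elim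
        (cut-obstruction closed u∈S v∉S t
          (pss-∋ (networkMatrix G T T-span) pss λ i → fromℚ (flow T i t))))
    ]′ (path-or-cut G u v)
    where
    t : Walk T u v
    t = proj₁ (proj₁ tree u v)

theorem3p1 : ∀ {p m n : ℕ} (G : Digraph p m) (T : Digraph p n) →
    Connected G → (T-span : IsOrientedSpanningTree G T) → 1 ℕ.≤ n →
    IsPositiveSpanningSet (networkMatrix G T T-span) (ℝ^ n) ⇔ StronglyConnected G
theorem3p1 G T _ T-span _ =
  mk⇔ (pss⇒stronglyConnected G T T-span) (stronglyConnected⇒pss G T T-span)
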